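{- Let $T_1$ and $T_2$ be two tournaments with $p$ and $q$ vertices respectively. (i) If $p$ and $q$ are even, then $T_1 \rightarrow T_2$ is unimodular if and only if $T_1$ and $T_2$ are both unimodular. (ii) If $p$ and $q$ are odd, then $T_1 \rightarrow T_2$ is unimodular if and only if $T_1^{+}$ and $T_2^{+}$ are both unimodular.
   Context: The skew-adjacency matrix of a tournament with vertex set $\{v_1,\ldots,v_n\}$ is the $n\times n$ zero-diagonal matrix $S=[s_{ij}]$ in which $s_{ij}=1$ and $s_{ji}=-1$ if $v_i$ dominates $v_j$ (i.e. the arc goes from $v_i$ to $v_j$). The determinant $\det(T)$ of a tournament $T$ is the determinant of its skew-adjacency matrix; $T$ is unimodular if $\det(T)=1$. The join $T_1\rightarrow T_2$ of a tournament $T_1$ to a tournament $T_2$ is the tournament obtained from the disjoint union of $T_1$ and $T_2$ by adding an arc from each vertex of $T_1$ to every vertex of $T_2$. For a tournament $T$, $T^{+}$ denotes the join of $T$ to a tournament with one vertex. -}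

module Defs where

open import Data.Empty using (⊥)
open import Data.Fin.Base using (Fin; zero; suc; toℕ; splitAt; join; punchIn)
open import Data.Fin.Properties using (join-splitAt)
open import Data.Integer.Base using (ℤ; 0ℤ; 1ℤ; -1ℤ; _*_; _^_)
open import Data.Integer.Properties using (+-*-semiring)
open import Data.Nat.Base using (ℕ; zero; suc; _+_)
open import Data.Sum.Base using (_⊎_)
open import Data.Sum.Relation.Binary.LeftOrder using (_⊎-<_; ⊎-<-trichotomous)
open import Data.Sum.Relation.Binary.Pointwise using (Pointwise; Pointwise-≡⇒≡; ≡⇒Pointwise-≡)
open import Data.Vec.Functional using (Vector)
open import Function.Base using (_∘_; _on_)
open import Level using (0ℓ)
open import Relation.Binary.Core using (Rel)
open import Relation.Binary.Definitions using (Trichotomous; Tri; tri<; tri≈; tri>)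
open import Relation.Binary.PropositionalEquality
  using (_≡_; refl; sym; trans; cong)
open import Algebra.Properties.Semiring.Sum +-*-semiring using (sum)

SquareMatrix : ℕ → Set
SquareMatrix n = Vector (Vector ℤ n) n

-- Laplace expansion along the first row; the empty determinant is 1.
det : ∀ {n} → SquareMatrix n → ℤ
det {zero}  M = 1ℤ
det {suc n} M =
  sum λ j → -1ℤ ^ toℕ j * (M zero j * det (λ i k → M (suc i) (punchIn j k)))

-- Trichotomy says that exactly one of "i dominates j", "i = j" and
-- "j dominates i" holds, so there are no loops and exactly one arc between
-- any two distinct vertices.  Dominance is not assumed to be transitive.
record Tournament (n : ℕ) : Set₁ where
  field
    _dominates_ : Rel (Fin n) 0ℓ
    compare     : Trichotomous _≡_ _dominates_

open Tournament

sign : ∀ {A B C : Set} → Tri A B C → ℤ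
sign (tri< _ _ _) = 1ℤ
sign (tri≈ _ _ _) = 0ℤ
sign (tri> _ _ _) = -1ℤ

skewAdjacency : ∀ {n} → Tournament n → SquareMatrix n
skewAdjacency T i j = sign (compare T i j)

detT : ∀ {n} → Tournament n → ℤ
detT T = det (skewAdjacency T)

Unimodular : ∀ {n} → Tournament n → Set
Unimodular T = detT T ≡ 1ℤ

splitAt-injective : ∀ m {n} {i j : Fin (m + n)} → splitAt m i ≡ splitAt m j → i ≡ j
splitAt-injective m {n} {i} {j} eq =
  trans (sym (join-splitAt m n i))
        (trans (cong (join m n) eq) (join-splitAt m n j))

infixr 5 _⇒_

-- The join.  Through splitAt, the first p elements of Fin (p + q) are the
-- vertices of T₁ and the last q those of T₂; _⊎-<_ keeps both relations and
-- relates everything on the left to everything on the right.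
_⇒_ : ∀ {p q} → Tournament p → Tournament q → Tournament (p + q)
_⇒_ {p} {q} T₁ T₂ = record
  { _dominates_ = arc on splitAt p
  ; compare     = λ i j →
      transfer (⊎-<-trichotomous (compare T₁) (compare T₂) (splitAt p i) (splitAt p j))
  }
  where
  arc : Rel (Fin p ⊎ Fin q) 0ℓ
  arc = _dominates_ T₁ ⊎-< _dominates_ T₂

  transfer : ∀ {A B : Set} {i j : Fin (p + q)} →
             Tri A (Pointwise _≡_ _≡_ (splitAt p i) (splitAt p j)) B →
             Tri A (i ≡ j) B
  transfer (tri< a ¬b ¬c) = tri< a (¬b ∘ ≡⇒Pointwise-≡ ∘ cong (splitAt p)) ¬c
  transfer (tri≈ ¬a b ¬c) = tri≈ ¬a (splitAt-injective p (Pointwise-≡⇒≡ b)) ¬c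
  transfer (tri> ¬a ¬b c) = tri> ¬a (¬b ∘ ≡⇒Pointwise-≡ ∘ cong (splitAt p)) c

oneVertex : Tournament 1
oneVertex = record
  { _dominates_ = λ _ _ → ⊥
  ; compare     = λ { zero zero → tri≈ (λ ()) refl (λ ()) }
  }

infix 8 _⁺

_⁺ : ∀ {n} → Tournament n → Tournament (n + 1)
T ⁺ = T ⇒ oneVertex

{-# OPTIONS --safe #-}
module Submission where

-- Row operations turn the skew-adjacency matrix of T₁ ⇒ T₂ into block triangular
-- form up to multilinearity and one row swap, which gives
--   det (T₁ ⇒ T₂) = det T₁ · det T₂ + e(T₁) · e(T₂)
-- where e(T) is the coefficient of x in det (S + x J), for S the skew-adjacency
-- matrix of T and J the all-ones matrix.  For a one-vertex T₂ this reads
-- det (T⁺) = e(T).  A skew-symmetric determinant of odd order vanishes, so only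
-- det T₁ · det T₂ survives when p and q are even, and only e(T₁) · e(T₂) when
-- they are odd.  A product of integers can be 1 with both factors -1; this is
-- excluded because a tournament T of even order has e(T) = 0 and hence
-- det T = det (S + J), where S + J is the identity plus twice a matrix of trace
-- zero, so that det T ≡ 1 (mod 4).

open import Defs
open import Data.Fin.Base using (Fin; zero; suc; toℕ; fromℕ<; splitAt; join; punchIn; _↑ˡ_; _↑ʳ_)
open import Data.Fin.Properties
  using (_≟_; suc-injective; 0≢1+n; toℕ<n; toℕ-fromℕ<; toℕ-injective; toℕ-↑ˡ;
         splitAt-↑ˡ; splitAt-↑ʳ; splitAt-join; join-splitAt)
open import Data.Integer.Base as Int using (ℤ; 0ℤ; 1ℤ; -1ℤ; _+_; _*_; _^_; -_; _-_; ∣_∣)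
open import Data.Integer.Divisibility.Signed as Signed using (divides)
open import Data.Integer.Properties
  using (+-*-semiring; +-identityˡ; +-identityʳ; +-assoc; *-zeroʳ; *-identityˡ;
         *-identityʳ; neg-involutive; abs-*; -1*i≡-i)
open import Data.Integer.Tactic.RingSolver using (solve-∀)
open import Data.Nat.Base as ℕ using (ℕ; zero; suc)
open import Data.Nat.Divisibility using (_∣_; _∤_; ∣-refl; ∣m∣n⇒∣m+n; ∣m+n∣m⇒∣n; ∣1⇒≡1; _∣0)
import Data.Nat.Properties as ℕ
open import Data.Product.Base using (_×_; _,_)
open import Data.Sum.Base using (_⊎_; inj₁; inj₂; map)
open import Data.Sum.Relation.Binary.LeftOrder using (⊎-<-trichotomous)
open import Data.Vec.Functional using (Vector; _∷_; updateAt)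
open import Data.Vec.Functional.Properties using (updateAt-updates; updateAt-minimal)
open import Function.Base using (_∘_; const; id)
open import Function.Bundles using (_⇔_; mk⇔)
open import Relation.Binary.Definitions using (tri<; tri≈; tri>)
open import Relation.Binary.PropositionalEquality
  using (_≡_; _≢_; refl; sym; trans; cong; cong₂; cong-app; subst; module ≡-Reasoning)
open import Relation.Nullary using (yes; no; contradiction)
open import Relation.Nullary.Decidable using (from-no)
open import Algebra.Properties.Semiring.Sum +-*-semiring
  using (sum; sum-cong-≗; sum-replicate-zero; ∑-distrib-+; ∑-comm; *-distribˡ-sum; *-distribʳ-sum)

open ≡-Reasoning
open Tournament

private
  variable
    n p q : ℕ

-- Finite sums

sum-zero : {f : Vector ℤ n} → (∀ i → f i ≡ 0ℤ) → sum f ≡ 0ℤ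
sum-zero {n} f≡0 = trans (sum-cong-≗ f≡0) (sum-replicate-zero n)

sum-linear : ∀ s {f} (g h : Vector ℤ n) → (∀ i → f i ≡ g i + s * h i) →
             sum f ≡ sum g + s * sum h
sum-linear s {f} g h eq = begin
  sum f                              ≡⟨ sum-cong-≗ eq ⟩
  sum (λ i → g i + s * h i)          ≡⟨ ∑-distrib-+ g (λ i → s * h i) ⟩
  sum g + sum (λ i → s * h i)        ≡⟨ cong (sum g +_) (*-distribˡ-sum s h) ⟨
  sum g + s * sum h                  ∎

sum-scale : ∀ s {f} (g : Vector ℤ n) → (∀ i → f i ≡ s * g i) → sum f ≡ s * sum g
sum-scale s g eq = trans (sum-cong-≗ eq) (sym (*-distribˡ-sum s g))

sum-splitAt : ∀ m (f : Vector ℤ (m ℕ.+ n)) →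
              sum f ≡ sum (λ i → f (i ↑ˡ n)) + sum (λ j → f (m ↑ʳ j))
sum-splitAt     zero    f = sym (+-identityˡ _)
sum-splitAt {n} (suc m) f =
  trans (cong (f zero +_) (sum-splitAt m (f ∘ suc)))
        (sym (+-assoc (f zero) (sum λ i → f (suc i ↑ˡ n)) (sum λ j → f (suc m ↑ʳ j))))

-- Determinants

minor : SquareMatrix (suc n) → Fin (suc n) → SquareMatrix n
minor M j i k = M (suc i) (punchIn j k)

laplaceTerm : SquareMatrix (suc n) → Vector ℤ (suc n)
laplaceTerm M j = -1ℤ ^ toℕ j * (M zero j * det (minor M j))

det-cong : {M N : SquareMatrix n} → (∀ i j → M i j ≡ N i j) → det M ≡ det N
det-cong {zero}  eq = refl
det-cong {suc n} eq = sum-cong-≗ λ j →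
  cong (-1ℤ ^ toℕ j *_)
       (cong₂ _*_ (eq zero j) (det-cong λ i k → eq (suc i) (punchIn j k)))

-- In the Laplace expansion the varying row is either the row of coefficients or a row of every
-- minor. The three matrices are compared entry by entry, so matrices of any shape can be supplied
-- without function extensionality.
det-linear : ∀ (i : Fin n) s {M P N : SquareMatrix n} →
             (∀ j → N i j ≡ M i j + s * P i j) →
             (∀ k → k ≢ i → ∀ j → N k j ≡ M k j) →
             (∀ k → k ≢ i → ∀ j → N k j ≡ P k j) →
             det N ≡ det M + s * det P
det-linear zero s {M} {P} {N} row N≡M N≡P = sum-linear s (laplaceTerm M) (laplaceTerm P) λ j → begin
  -1ℤ ^ toℕ j * (N zero j * det (minor N j))
    ≡⟨ cong (λ x → -1ℤ ^ toℕ j * (x * det (minor N j))) (row j) ⟩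
  -1ℤ ^ toℕ j * ((M zero j + s * P zero j) * det (minor N j))
    ≡⟨ expand (-1ℤ ^ toℕ j) (M zero j) s (P zero j) (det (minor N j)) ⟩
  -1ℤ ^ toℕ j * (M zero j * det (minor N j)) + s * (-1ℤ ^ toℕ j * (P zero j * det (minor N j)))
    ≡⟨ cong₂ (λ x y → -1ℤ ^ toℕ j * (M zero j * x) + s * (-1ℤ ^ toℕ j * (P zero j * y)))
             (det-cong λ i k → N≡M (suc i) (λ ()) (punchIn j k))
             (det-cong λ i k → N≡P (suc i) (λ ()) (punchIn j k)) ⟩
  -1ℤ ^ toℕ j * (M zero j * det (minor M j)) + s * (-1ℤ ^ toℕ j * (P zero j * det (minor P j))) ∎
  where
  expand : ∀ σ a s b d → σ * ((a + s * b) * d) ≡ σ * (a * d) + s * (σ * (b * d))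
  expand = solve-∀
det-linear (suc i) s {M} {P} {N} row N≡M N≡P = sum-linear s (laplaceTerm M) (laplaceTerm P) λ j → begin
  -1ℤ ^ toℕ j * (N zero j * det (minor N j))
    ≡⟨ cong (λ x → -1ℤ ^ toℕ j * (N zero j * x))
            (det-linear i s (λ k → row (punchIn j k))
              (λ k k≢i l → N≡M (suc k) (k≢i ∘ suc-injective) (punchIn j l))
              (λ k k≢i l → N≡P (suc k) (k≢i ∘ suc-injective) (punchIn j l))) ⟩
  -1ℤ ^ toℕ j * (N zero j * (det (minor M j) + s * det (minor P j)))
    ≡⟨ expand (-1ℤ ^ toℕ j) (N zero j) s (det (minor M j)) (det (minor P j)) ⟩
  -1ℤ ^ toℕ j * (N zero j * det (minor M j)) + s * (-1ℤ ^ toℕ j * (N zero j * det (minor P j)))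
    ≡⟨ cong₂ (λ x y → -1ℤ ^ toℕ j * (x * det (minor M j)) + s * (-1ℤ ^ toℕ j * (y * det (minor P j))))
             (N≡M zero (λ ()) j) (N≡P zero (λ ()) j) ⟩
  -1ℤ ^ toℕ j * (M zero j * det (minor M j)) + s * (-1ℤ ^ toℕ j * (P zero j * det (minor P j))) ∎
  where
  expand : ∀ σ a s d e → σ * (a * (d + s * e)) ≡ σ * (a * d) + s * (σ * (a * e))
  expand = solve-∀

det-negate : (M : SquareMatrix n) → det (λ i j → - M i j) ≡ -1ℤ ^ n * det M
det-negate {zero}  M = refl
det-negate {suc n} M = sum-scale (-1ℤ ^ suc n) (laplaceTerm M) λ j → begin
  -1ℤ ^ toℕ j * (- M zero j * det (λ i k → - minor M j i k))
    ≡⟨ cong (λ x → -1ℤ ^ toℕ j * (- M zero j * x)) (det-negate (minor M j)) ⟩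
  -1ℤ ^ toℕ j * (- M zero j * (-1ℤ ^ n * det (minor M j)))
    ≡⟨ rearrange (-1ℤ ^ toℕ j) (M zero j) (-1ℤ ^ n) (det (minor M j)) ⟩
  -1ℤ ^ suc n * (-1ℤ ^ toℕ j * (M zero j * det (minor M j))) ∎
  where
  rearrange : ∀ σ a τ d → σ * (- a * (τ * d)) ≡ (-1ℤ * τ) * (σ * (a * d))
  rearrange = solve-∀

-- Expanding every minor but the first once more, along the other border, turns
-- both sides into the same double sum over the minors with two rows and two
-- columns deleted.
det-firstColumn : (M : SquareMatrix (suc n)) →
  det M ≡ sum λ i → -1ℤ ^ toℕ i * (M i zero * det (λ k l → M (punchIn i k) (suc l)))
det-firstColumn {zero}  M = refl
det-firstColumn {suc n} M = cong (-1ℤ ^ 0 * (M zero zero * det (minor M zero)) +_) (begin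
  sum (λ j → -1ℤ ^ suc (toℕ j) * (M zero (suc j) * det (minor M (suc j))))
    ≡⟨ sum-cong-≗ (λ j → cong (λ x → -1ℤ ^ suc (toℕ j) * (M zero (suc j) * x))
                              (det-firstColumn (minor M (suc j)))) ⟩
  sum (λ j → -1ℤ ^ suc (toℕ j) * (M zero (suc j) *
         sum (λ i → -1ℤ ^ toℕ i * (M (suc i) zero * D i j))))
    ≡⟨ sum-cong-≗ (λ j → nested (-1ℤ ^ suc (toℕ j)) (M zero (suc j))
                                    (λ i → -1ℤ ^ toℕ i * (M (suc i) zero * D i j))) ⟩
  sum (λ j → sum (λ i → -1ℤ ^ suc (toℕ j) * (M zero (suc j) * (-1ℤ ^ toℕ i * (M (suc i) zero * D i j)))))
    ≡⟨ ∑-comm (λ j i → -1ℤ ^ suc (toℕ j) * (M zero (suc j) * (-1ℤ ^ toℕ i * (M (suc i) zero * D i j)))) ⟩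
  sum (λ i → sum (λ j → -1ℤ ^ suc (toℕ j) * (M zero (suc j) * (-1ℤ ^ toℕ i * (M (suc i) zero * D i j)))))
    ≡⟨ sum-cong-≗ (λ i → sum-cong-≗ λ j →
         exchange (-1ℤ ^ toℕ j) (M zero (suc j)) (-1ℤ ^ toℕ i) (M (suc i) zero) (D i j)) ⟩
  sum (λ i → sum (λ j → -1ℤ ^ suc (toℕ i) * (M (suc i) zero * (-1ℤ ^ toℕ j * (M zero (suc j) * D i j)))))
    ≡⟨ sum-cong-≗ (λ i → nested (-1ℤ ^ suc (toℕ i)) (M (suc i) zero)
                                    (λ j → -1ℤ ^ toℕ j * (M zero (suc j) * D i j))) ⟨
  sum (λ i → -1ℤ ^ suc (toℕ i) * (M (suc i) zero *
         det (λ k l → M (punchIn (suc i) k) (suc l)))) ∎)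
  where
  D : Fin (suc n) → Fin (suc n) → ℤ
  D i j = det λ k l → M (suc (punchIn i k)) (suc (punchIn j l))
  nested : ∀ {m} a b (f : Vector ℤ m) → a * (b * sum f) ≡ sum (λ i → a * (b * f i))
  nested a b f = trans (cong (a *_) (*-distribˡ-sum b f)) (*-distribˡ-sum a (λ i → b * f i))
  exchange : ∀ σ a τ b d → (-1ℤ * σ) * (a * (τ * (b * d))) ≡ (-1ℤ * τ) * (b * (σ * (a * d)))
  exchange = solve-∀

-- Expanding the transpose along its first row is expanding `M` along its first column, once the
-- minors are transposed back by induction.
det-transpose : (M : SquareMatrix n) → det (λ i j → M j i) ≡ det M
det-transpose {zero}  M = refl
det-transpose {suc n} M = begin
  det (λ i j → M j i)
    ≡⟨ sum-cong-≗ (λ j → cong (λ x → -1ℤ ^ toℕ j * (M j zero * x))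
                              (det-transpose (λ k l → M (punchIn j k) (suc l)))) ⟩
  sum (λ j → -1ℤ ^ toℕ j * (M j zero * det (λ k l → M (punchIn j k) (suc l))))
    ≡⟨ det-firstColumn M ⟨
  det M ∎

-- Determinants with equal rows

laplace-zero : (M : SquareMatrix (suc n)) →
               (∀ j → M zero j ≡ 0ℤ ⊎ det (minor M j) ≡ 0ℤ) → det M ≡ 0ℤ
laplace-zero M vanish = sum-zero λ j → term (-1ℤ ^ toℕ j) (vanish j)
  where
  term : ∀ σ {a d} → a ≡ 0ℤ ⊎ d ≡ 0ℤ → σ * (a * d) ≡ 0ℤ
  term σ {a} {d} (inj₁ refl) = *-zeroʳ σ
  term σ {a} {d} (inj₂ refl) = trans (cong (σ *_) (*-zeroʳ a)) (*-zeroʳ σ)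

-- The first two Laplace terms have equal entries, equal minors and opposite signs, so they cancel.
-- Every later minor still contains both equal columns, and the mutual lemma treats it by induction.
det-equalColumns₀₁ : (M : SquareMatrix (suc (suc n))) →
                     (∀ i → M i zero ≡ M i (suc zero)) → det M ≡ 0ℤ
minor-equalColumns₀₁ : (M : SquareMatrix (suc (suc n))) →
                       (∀ i → M (suc i) zero ≡ M (suc i) (suc zero)) →
                       ∀ j → det (minor M (suc (suc j))) ≡ 0ℤ

det-equalColumns₀₁ {n} M eq = begin
  1ℤ * (M zero zero * det (minor M zero)) +
    (-1ℤ * (M zero (suc zero) * det (minor M (suc zero))) + rest)
    ≡⟨ cong₂ (λ x d → 1ℤ * (x * d) + (-1ℤ * (M zero (suc zero) * det (minor M (suc zero))) + rest))
             (eq zero) (det-cong {M = minor M zero} {minor M (suc zero)} λ { i zero → sym (eq (suc i)) ; i (suc k) → refl }) ⟩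
  1ℤ * (M zero (suc zero) * det (minor M (suc zero))) +
    (-1ℤ * (M zero (suc zero) * det (minor M (suc zero))) + rest)
    ≡⟨ cancel (M zero (suc zero)) (det (minor M (suc zero))) rest ⟩
  rest
    ≡⟨ sum-zero {n} (λ j → trans
         (cong (λ d → -1ℤ ^ toℕ (suc (suc j)) * (M zero (suc (suc j)) * d))
               (minor-equalColumns₀₁ M (eq ∘ suc) j))
         (zeros (-1ℤ ^ toℕ (suc (suc j))) (M zero (suc (suc j))))) ⟩
  0ℤ ∎
  where
  rest : ℤ
  rest = sum λ (j : Fin n) → laplaceTerm M (suc (suc j))
  cancel : ∀ a d r → 1ℤ * (a * d) + (-1ℤ * (a * d) + r) ≡ r
  cancel = solve-∀
  zeros : ∀ σ a → σ * (a * 0ℤ) ≡ 0ℤ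
  zeros = solve-∀

minor-equalColumns₀₁ {suc n} M eq j = det-equalColumns₀₁ (minor M (suc (suc j))) eq

det-equalRows₀₁ : (M : SquareMatrix (suc (suc n))) →
                  (∀ j → M zero j ≡ M (suc zero) j) → det M ≡ 0ℤ
det-equalRows₀₁ M eq = trans (sym (det-transpose M)) (det-equalColumns₀₁ (λ i j → M j i) eq)

-- Alternation for a single pair of rows. Naming it lets a row swap assume it for its own pair only,
-- so that pairs already settled can be used to reach further ones.
VanishesOnEqualRows : Fin n → Fin n → Set
VanishesOnEqualRows {n} i j = (M : SquareMatrix n) → (∀ k → M i k ≡ M j k) → det M ≡ 0ℤ

setRows : Fin n → Fin n → Vector ℤ n → Vector ℤ n → SquareMatrix n → SquareMatrix n
setRows i j u v M = updateAt (updateAt M j (const v)) i (const u)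

module _ {i j : Fin n} (i≢j : i ≢ j) (M : SquareMatrix n) where

  setRows-first : ∀ u v → setRows i j u v M i ≡ u
  setRows-first u v = updateAt-updates i (updateAt M j (const v))

  setRows-second : ∀ u v → setRows i j u v M j ≡ v
  setRows-second u v = trans (updateAt-minimal j i (updateAt M j (const v)) (i≢j ∘ sym))
                             (updateAt-updates j M)

  setRows-other : ∀ u v k → k ≢ i → k ≢ j → setRows i j u v M k ≡ M k
  setRows-other u v k k≢i k≢j = trans (updateAt-minimal k i (updateAt M j (const v)) k≢i)
                                      (updateAt-minimal k j M k≢j)

  setRows-unique : ∀ {u v} (N : SquareMatrix n) → (∀ l → N i l ≡ u l) → (∀ l → N j l ≡ v l) →
                   (∀ k → k ≢ i → k ≢ j → ∀ l → N k l ≡ M k l) →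
                   ∀ k l → setRows i j u v M k l ≡ N k l
  setRows-unique {u} {v} N Ni Nj Nk k l with k ≟ i | k ≟ j
  ... | yes refl | _        = trans (cong-app (setRows-first u v) l) (sym (Ni l))
  ... | no _     | yes refl = trans (cong-app (setRows-second u v) l) (sym (Nj l))
  ... | no k≢i   | no k≢j   = trans (cong-app (setRows-other u v k k≢i k≢j) l)
                                    (sym (Nk k k≢i k≢j l))

  -- Polarisation: with `f u v` the determinant having `u` and `v` in rows `i` and `j`, expanding
  -- `f x+y x+y` bilinearly and dropping the three diagonal values leaves `f x y + f y x` equal to
  -- zero.
  det-swapRows : VanishesOnEqualRows i j → (N : SquareMatrix n) →
                 (∀ l → N i l ≡ M j l) → (∀ l → N j l ≡ M i l) →
                 (∀ k → k ≢ i → k ≢ j → ∀ l → N k l ≡ M k l) →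
                 det N ≡ - det M
  det-swapRows vanish N Ni Nj Nk = begin
    det N        ≡⟨ det-cong (setRows-unique N Ni Nj Nk) ⟨
    f y x        ≡⟨ isolate (f x x) (f x y) (f y x) (f y y) ⟩
    ((f x x + 1ℤ * f x y) + 1ℤ * (f y x + 1ℤ * f y y)) - f x x - f y y - f x y
                 ≡⟨ cong (λ z → z - f x x - f y y - f x y)
                         (cong₂ (λ a b → a + 1ℤ * b) (linear₂ x x y) (linear₂ y x y)) ⟨
    (f x x+y + 1ℤ * f y x+y) - f x x - f y y - f x y
                 ≡⟨ cong (λ z → z - f x x - f y y - f x y) (linear₁ x y x+y) ⟨
    f x+y x+y - f x x - f y y - f x y
                 ≡⟨ cong₂ (λ a b → a - b - f y y - f x y) (diagonal x+y) (diagonal x) ⟩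
    0ℤ - 0ℤ - f y y - f x y
                 ≡⟨ cong₂ (λ a b → 0ℤ - 0ℤ - a - b) (diagonal y)
                          (det-cong (setRows-unique M (λ _ → refl) (λ _ → refl) (λ _ _ _ _ → refl))) ⟩
    0ℤ - 0ℤ - 0ℤ - det M
                 ≡⟨ +-identityˡ (- det M) ⟩
    - det M      ∎
    where
    x y x+y : Vector ℤ n
    x = M i
    y = M j
    -- The factor `1ℤ` matches the shape of `det-linear` with scalar 1.
    x+y l = x l + 1ℤ * y l
    f : Vector ℤ n → Vector ℤ n → ℤ
    f u v = det (setRows i j u v M)
    diagonal : ∀ u → f u u ≡ 0ℤ
    diagonal u = vanish _ λ k → cong-app (trans (setRows-first u u) (sym (setRows-second u u))) k
    linear₁ : ∀ u u′ v → f (λ l → u l + 1ℤ * u′ l) v ≡ f u v + 1ℤ * f u′ v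
    linear₁ u u′ v = det-linear i 1ℤ
      (λ l → trans (cong-app (setRows-first _ v) l)
                   (cong₂ (λ a b → a l + 1ℤ * b l) (sym (setRows-first u v)) (sym (setRows-first u′ v))))
      (λ k k≢i l → cong-app (off k k≢i u) l)
      (λ k k≢i l → cong-app (off k k≢i u′) l)
      where
      off : ∀ k → k ≢ i → ∀ w → setRows i j (λ l → u l + 1ℤ * u′ l) v M k ≡ setRows i j w v M k
      off k k≢i w = trans (updateAt-minimal k i (updateAt M j (const v)) k≢i)
                          (sym (updateAt-minimal k i (updateAt M j (const v)) k≢i))
    linear₂ : ∀ u v v′ → f u (λ l → v l + 1ℤ * v′ l) ≡ f u v + 1ℤ * f u v′
    linear₂ u v v′ = det-linear j 1ℤ
      (λ l → trans (cong-app (setRows-second u _) l)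
                   (cong₂ (λ a b → a l + 1ℤ * b l) (sym (setRows-second u v)) (sym (setRows-second u v′))))
      (λ k k≢j l → cong-app (off k k≢j v) l)
      (λ k k≢j l → cong-app (off k k≢j v′) l)
      where
      off : ∀ k → k ≢ j → ∀ w → setRows i j u (λ l → v l + 1ℤ * v′ l) M k ≡ setRows i j u w M k
      off k k≢j w with k ≟ i
      ... | yes refl = trans (setRows-first u _) (sym (setRows-first u w))
      ... | no k≢i   = trans (setRows-other u _ k k≢i k≢j) (sym (setRows-other u w k k≢i k≢j))
    isolate : ∀ a b c d → c ≡ ((a + 1ℤ * b) + 1ℤ * (c + 1ℤ * d)) - a - d - b
    isolate = solve-∀

-- Neither row is the one expanded along, so both survive in every minor.
vanishesOnEqualRows-suc : {i j : Fin n} → VanishesOnEqualRows i j →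
                          VanishesOnEqualRows (suc i) (suc j)
vanishesOnEqualRows-suc vanish M eq =
  laplace-zero M λ j → inj₂ (vanish (minor M j) (eq ∘ punchIn j))

vanishesOnEqualRows-zero : (j : Fin n) → VanishesOnEqualRows zero (suc j)
vanishesOnEqualRows-zero zero    = det-equalRows₀₁
-- Swapping rows 1 and j + 2 reduces to equal rows 0 and 1.
vanishesOnEqualRows-zero (suc j) M eq = begin
  det M       ≡⟨ neg-involutive (det M) ⟨
  - - det M   ≡⟨ cong -_ (det-swapRows 1≢2+j M
                   (vanishesOnEqualRows-suc (vanishesOnEqualRows-zero j)) N
                   (cong-app (setRows-first 1≢2+j M u v)) (cong-app (setRows-second 1≢2+j M u v))
                   (λ k k≢i k≢j → cong-app (setRows-other 1≢2+j M u v k k≢i k≢j))) ⟨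
  - det N     ≡⟨ cong -_ (det-equalRows₀₁ N eq) ⟩
  0ℤ          ∎
  where
  1≢2+j : suc zero ≢ suc (suc j)
  1≢2+j ()
  u = M (suc (suc j))
  v = M (suc zero)
  N = setRows (suc zero) (suc (suc j)) u v M

vanishesOnEqualRows : (i j : Fin n) → i ≢ j → VanishesOnEqualRows i j
vanishesOnEqualRows zero    zero    0≢0      = contradiction refl 0≢0
vanishesOnEqualRows zero    (suc j) _        = vanishesOnEqualRows-zero j
vanishesOnEqualRows (suc i) zero    _   M eq = vanishesOnEqualRows-zero i M (sym ∘ eq)
vanishesOnEqualRows (suc i) (suc j) i≢j      =
  vanishesOnEqualRows-suc (vanishesOnEqualRows i j (i≢j ∘ cong suc))

-- Row operations

det-addRow : ∀ (i k : Fin n) s {M N : SquareMatrix n} → k ≢ i →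
             (∀ j → N k j ≡ M k j + s * M i j) →
             (∀ l → l ≢ k → ∀ j → N l j ≡ M l j) → det N ≡ det M
det-addRow i k s {M} {N} k≢i row others = begin
  det N               ≡⟨ det-linear k s
                           (λ j → trans (row j) (cong (λ r → M k j + s * r j) (sym Pk)))
                           others
                           (λ l l≢k j → trans (others l l≢k j)
                                              (sym (cong-app (updateAt-minimal l k M l≢k) j))) ⟩
  -- `P` carries row `i` of `M` both at `k` and at `i`.
  det M + s * det P   ≡⟨ cong (λ d → det M + s * d) (vanishesOnEqualRows k i k≢i P
                           (cong-app (trans Pk (sym (updateAt-minimal i k M (k≢i ∘ sym)))))) ⟩
  det M + s * 0ℤ      ≡⟨ cong (λ z → det M + z) (*-zeroʳ s) ⟩
  det M + 0ℤ          ≡⟨ +-identityʳ (det M) ⟩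
  det M               ∎
  where
  P = updateAt M k (const (M i))
  Pk : P k ≡ M i
  Pk = updateAt-updates k M

-- Since `c i` is zero, the source row stays fixed and the additions can be undone one at a time.
-- The induction is on a bound for the indices where `c` may be nonzero; each step clears the
-- coefficient at the last such index.
det-addMultiples : ∀ (i : Fin n) (c : Vector ℤ n) {M N : SquareMatrix n} → c i ≡ 0ℤ →
                   (∀ k j → N k j ≡ M k j + c k * M i j) → det N ≡ det M
det-addMultiples {n} i c {M} ci≡0 = go n c ci≡0 λ k n≤k → contradiction (toℕ<n k) (ℕ.≤⇒≯ n≤k)
  where
  vanishing : ∀ {z} x y → z ≡ 0ℤ → x + z * y ≡ x
  vanishing x y refl = +-identityʳ x
  go : ∀ m (c : Vector ℤ n) {N : SquareMatrix n} → c i ≡ 0ℤ → (∀ k → m ℕ.≤ toℕ k → c k ≡ 0ℤ) →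
       (∀ k j → N k j ≡ M k j + c k * M i j) → det N ≡ det M
  go zero    c ci≡0 supp eq =
    det-cong λ k j → trans (eq k j) (vanishing (M k j) (M i j) (supp k ℕ.z≤n))
  go (suc m) c {N} ci≡0 supp eq with m ℕ.<? n
  ... | no m≮n = go m c ci≡0 (λ k m≤k → contradiction (ℕ.≤-<-trans m≤k (toℕ<n k)) m≮n) eq
  ... | yes m<n = trans step (go m c′ c′i≡0 supp′ (λ _ _ → refl))
    where
    k₀ = fromℕ< m<n
    c′ = updateAt c k₀ (const 0ℤ)
    N′ : SquareMatrix n
    N′ k j = M k j + c′ k * M i j
    c′k₀≡0 : c′ k₀ ≡ 0ℤ
    c′k₀≡0 = updateAt-updates k₀ c
    c′-other : ∀ k → k ≢ k₀ → c′ k ≡ c k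
    c′-other k k≢k₀ = updateAt-minimal k k₀ c k≢k₀
    c′i≡0 : c′ i ≡ 0ℤ
    c′i≡0 with i ≟ k₀
    ... | yes i≡k₀ = trans (cong c′ i≡k₀) c′k₀≡0
    ... | no i≢k₀  = trans (c′-other i i≢k₀) ci≡0
    supp′ : ∀ k → m ℕ.≤ toℕ k → c′ k ≡ 0ℤ
    supp′ k m≤k with k ≟ k₀
    ... | yes k≡k₀ = trans (cong c′ k≡k₀) c′k₀≡0
    ... | no k≢k₀  = trans (c′-other k k≢k₀) (supp k (ℕ.≤∧≢⇒< m≤k λ m≡k →
                       k≢k₀ (toℕ-injective (trans (sym m≡k) (sym (toℕ-fromℕ< m<n))))))
    others : ∀ k → k ≢ k₀ → ∀ j → N k j ≡ N′ k j
    others k k≢k₀ j = trans (eq k j) (cong (λ z → M k j + z * M i j) (sym (c′-other k k≢k₀)))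
    step : det N ≡ det N′
    step with k₀ ≟ i
    -- The coefficient at `k₀` was zero already, so clearing it changes nothing.
    ... | yes k₀≡i = det-cong λ k j → trans (eq k j) (cong (λ z → M k j + z * M i j) (sym (same k)))
      where
      same : ∀ k → c′ k ≡ c k
      same k with k ≟ k₀
      ... | yes refl = trans c′k₀≡0 (sym (trans (cong c k₀≡i) ci≡0))
      ... | no k≢k₀  = c′-other k k≢k₀
    -- Row `i` of `N′` is still row `i` of `M`, so adding `c k₀` times it to row `k₀` of `N′`
    -- recovers `N`.
    ... | no k₀≢i = det-addRow i k₀ (c k₀) k₀≢i
      (λ j → trans (eq k₀ j) (sym (cong₂ (λ x y → x + c k₀ * y)
        (vanishing (M k₀ j) (M i j) c′k₀≡0) (vanishing (M i j) (M i j) c′i≡0))))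
      others

-- Block matrices

-- Indexing by a disjoint union makes the choice of a block a pattern match and agrees with the use
-- of `splitAt` in `_⇒_`.
BlockMatrix : ℕ → ℕ → Set
BlockMatrix p q = Fin p ⊎ Fin q → Fin p ⊎ Fin q → ℤ

flatten : BlockMatrix p q → SquareMatrix (p ℕ.+ q)
flatten {p} E i j = E (splitAt p i) (splitAt p j)

module _ {p q : ℕ} where

  join-≢ : {x : Fin p ⊎ Fin q} {k : Fin (p ℕ.+ q)} → k ≢ join p q x → splitAt p k ≢ x
  join-≢ {k = k} k≢x eq = k≢x (trans (sym (join-splitAt p q k)) (cong (join p q) eq))

  join-injective : {x y : Fin p ⊎ Fin q} → join p q x ≡ join p q y → x ≡ y
  join-injective {x} {y} eq =
    trans (sym (splitAt-join p q x)) (trans (cong (splitAt p) eq) (splitAt-join p q y))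

  at-join : ∀ {A : Set} (f : Fin p ⊎ Fin q → A) x → f (splitAt p (join p q x)) ≡ f x
  at-join f x = cong f (splitAt-join p q x)

  flatten-cong : {M N : BlockMatrix p q} → (∀ x y → M x y ≡ N x y) →
                 det (flatten M) ≡ det (flatten N)
  flatten-cong eq = det-cong λ i j → eq (splitAt p i) (splitAt p j)

  -- This lemma and the next two carry the row operations across the bijection of `splitAt` and
  -- `join`, so that their hypotheses can be checked block by block.
  flatten-linear : ∀ x s {M P N : BlockMatrix p q} →
                   (∀ y → N x y ≡ M x y + s * P x y) →
                   (∀ z → z ≢ x → ∀ y → N z y ≡ M z y) →
                   (∀ z → z ≢ x → ∀ y → N z y ≡ P z y) →
                   det (flatten N) ≡ det (flatten M) + s * det (flatten P)
  flatten-linear x s {M} {P} {N} row N≡M N≡P = det-linear (join p q x) s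
    (λ j → subst (λ z → N z (splitAt p j) ≡ M z (splitAt p j) + s * P z (splitAt p j))
                 (sym (splitAt-join p q x)) (row (splitAt p j)))
    (λ k k≢x j → N≡M (splitAt p k) (join-≢ k≢x) (splitAt p j))
    (λ k k≢x j → N≡P (splitAt p k) (join-≢ k≢x) (splitAt p j))

  flatten-addMultiples : ∀ x (c : Fin p ⊎ Fin q → ℤ) {M N : BlockMatrix p q} → c x ≡ 0ℤ →
                         (∀ z y → N z y ≡ M z y + c z * M x y) →
                         det (flatten N) ≡ det (flatten M)
  flatten-addMultiples x c {M} {N} cx≡0 eq = det-addMultiples (join p q x) (c ∘ splitAt p)
    (trans (at-join c x) cx≡0)
    (λ k j → subst (λ w → N (splitAt p k) (splitAt p j) ≡
                          M (splitAt p k) (splitAt p j) + c (splitAt p k) * M w (splitAt p j))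
                   (sym (splitAt-join p q x)) (eq (splitAt p k) (splitAt p j)))

  flatten-swapRows : ∀ x y → x ≢ y → {M N : BlockMatrix p q} →
                     (∀ w → N x w ≡ M y w) → (∀ w → N y w ≡ M x w) →
                     (∀ z → z ≢ x → z ≢ y → ∀ w → N z w ≡ M z w) →
                     det (flatten N) ≡ - det (flatten M)
  flatten-swapRows x y x≢y {M} {N} Nx Ny Nz =
    det-swapRows x≢y′ (flatten M) (vanishesOnEqualRows (join p q x) (join p q y) x≢y′) (flatten N)
      (λ l → trans (at-join (λ z → N z (splitAt p l)) x)
                   (trans (Nx (splitAt p l)) (sym (at-join (λ z → M z (splitAt p l)) y))))
      (λ l → trans (at-join (λ z → N z (splitAt p l)) y)
                   (trans (Ny (splitAt p l)) (sym (at-join (λ z → M z (splitAt p l)) x))))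
      (λ k k≢x k≢y l → Nz (splitAt p k) (join-≢ k≢x) (join-≢ k≢y) (splitAt p l))
    where
    x≢y′ : join p q x ≢ join p q y
    x≢y′ = x≢y ∘ join-injective

block : SquareMatrix p → (Fin p → Fin q → ℤ) → (Fin q → Fin p → ℤ) → SquareMatrix q → BlockMatrix p q
block A U C B (inj₁ i) (inj₁ j) = A i j
block A U C B (inj₁ i) (inj₂ j) = U i j
block A U C B (inj₂ i) (inj₁ j) = C i j
block A U C B (inj₂ i) (inj₂ j) = B i j

-- Deleting a column of the left half respects the splitting, so such a minor of a block matrix is
-- again a block matrix.
splitAt-punchIn-↑ˡ : ∀ (j : Fin (suc p)) (k : Fin (p ℕ.+ q)) →
                     splitAt (suc p) (punchIn (j ↑ˡ q) k) ≡ map (punchIn j) id (splitAt p k)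
splitAt-punchIn-↑ˡ {p}     zero    k       = refl
splitAt-punchIn-↑ˡ {suc p} (suc j) zero    = refl
splitAt-punchIn-↑ˡ {suc p} (suc j) (suc k)
  rewrite splitAt-punchIn-↑ˡ j k with splitAt p k
... | inj₁ _ = refl
... | inj₂ _ = refl

-- Induction on `p` along the first row: its entries in the right half vanish, and deleting a column
-- of the left half gives a block triangular matrix with a minor of `A` in the corner.
det-lowerBlock : ∀ (A : SquareMatrix p) {U} C (B : SquareMatrix q) → (∀ i j → U i j ≡ 0ℤ) →
                 det (flatten (block A U C B)) ≡ det A * det B
det-lowerBlock {zero}      A C B U≡0 = sym (*-identityˡ (det B))
det-lowerBlock {suc p} {q} A {U} C B U≡0 = begin
  sum (laplaceTerm M)
    ≡⟨ sum-splitAt (suc p) (laplaceTerm M) ⟩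
  sum (λ j → laplaceTerm M (j ↑ˡ q)) + sum (λ j → laplaceTerm M (suc p ↑ʳ j))
    ≡⟨ cong₂ _+_ (sum-cong-≗ left) (sum-zero right) ⟩
  sum (λ j → laplaceTerm A j * det B) + 0ℤ
    ≡⟨ +-identityʳ _ ⟩
  sum (λ j → laplaceTerm A j * det B)
    ≡⟨ *-distribʳ-sum (det B) (laplaceTerm A) ⟨
  det A * det B ∎
  where
  M = flatten (block A U C B)
  minor-block : ∀ j → det (minor M (j ↑ˡ q)) ≡ det (minor A j) * det B
  minor-block j = trans (det-cong λ i k →
      trans (cong (block A U C B (map suc id (splitAt p i))) (splitAt-punchIn-↑ˡ j k))
            (entry (splitAt p i) (splitAt p k)))
    (det-lowerBlock (minor A j) (λ i k → C i (punchIn j k)) B (U≡0 ∘ suc))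
    where
    entry : ∀ x y → block A U C B (map suc id x) (map (punchIn j) id y) ≡
                    block (minor A j) (U ∘ suc) (λ i k → C i (punchIn j k)) B x y
    entry (inj₁ _) (inj₁ _) = refl
    entry (inj₁ _) (inj₂ _) = refl
    entry (inj₂ _) (inj₁ _) = refl
    entry (inj₂ _) (inj₂ _) = refl
  left : ∀ j → laplaceTerm M (j ↑ˡ q) ≡ laplaceTerm A j * det B
  left j = begin
    -1ℤ ^ toℕ (j ↑ˡ q) * (M zero (j ↑ˡ q) * det (minor M (j ↑ˡ q)))
      ≡⟨ cong₂ (λ e a → -1ℤ ^ e * (a * det (minor M (j ↑ˡ q)))) (toℕ-↑ˡ j q)
               (cong (block A U C B (inj₁ zero)) (splitAt-↑ˡ (suc p) j q)) ⟩
    -1ℤ ^ toℕ j * (A zero j * det (minor M (j ↑ˡ q)))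
      ≡⟨ cong (λ d → -1ℤ ^ toℕ j * (A zero j * d)) (minor-block j) ⟩
    -1ℤ ^ toℕ j * (A zero j * (det (minor A j) * det B))
      ≡⟨ reassociate (-1ℤ ^ toℕ j) (A zero j) (det (minor A j)) (det B) ⟩
    laplaceTerm A j * det B ∎
    where
    reassociate : ∀ σ a d b → σ * (a * (d * b)) ≡ σ * (a * d) * b
    reassociate = solve-∀
  right : ∀ j → laplaceTerm M (suc p ↑ʳ j) ≡ 0ℤ
  right j = trans
    (cong (λ a → -1ℤ ^ toℕ (suc p ↑ʳ j) * (a * det (minor M (suc p ↑ʳ j))))
          (trans (cong (block A U C B (inj₁ zero)) (splitAt-↑ʳ (suc p) q j)) (U≡0 zero j)))
    (*-zeroʳ (-1ℤ ^ toℕ (suc p ↑ʳ j)))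

det-upperBlock : ∀ (A : SquareMatrix p) U {C} (B : SquareMatrix q) → (∀ i j → C i j ≡ 0ℤ) →
                 det (flatten (block A U C B)) ≡ det A * det B
det-upperBlock {p} A U {C} B C≡0 = begin
  det (flatten (block A U C B))
    ≡⟨ det-transpose (flatten (block A U C B)) ⟨
  det (λ i j → flatten (block A U C B) j i)
    ≡⟨ flatten-cong transposed ⟩
  det (flatten (block (λ i j → A j i) (λ i j → C j i) (λ i j → U j i) (λ i j → B j i)))
    ≡⟨ det-lowerBlock (λ i j → A j i) (λ i j → U j i) (λ i j → B j i) (λ i j → C≡0 j i) ⟩
  det (λ i j → A j i) * det (λ i j → B j i)
    ≡⟨ cong₂ _*_ (det-transpose A) (det-transpose B) ⟩
  det A * det B ∎
  where
  transposed : ∀ x y → block A U C B y x ≡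
               block (λ i j → A j i) (λ i j → C j i) (λ i j → U j i) (λ i j → B j i) x y
  transposed (inj₁ _) (inj₁ _) = refl
  transposed (inj₁ _) (inj₂ _) = refl
  transposed (inj₂ _) (inj₁ _) = refl
  transposed (inj₂ _) (inj₂ _) = refl

-- Row differences and the determinant of a join matrix

differences : SquareMatrix (suc n) → Fin n → Vector ℤ (suc n)
differences A i j = A (suc i) j + -1ℤ * A zero j

det-differences : (A : SquareMatrix (suc n)) → det (A zero ∷ differences A) ≡ det A
det-differences A = det-addMultiples zero (0ℤ ∷ const -1ℤ) {A} {A zero ∷ differences A} refl λ
  { zero    j → sym (+-identityʳ (A zero j))
  ; (suc _) j → refl
  }

-- det (A + x J) = det A + x · excess A for the all-ones matrix J.
excess : SquareMatrix (suc n) → ℤ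
excess A = det (const 1ℤ ∷ differences A)

-- Row differences do not change when 1 is added to every entry. After the reduction only the first
-- row differs, and linearity in that row splits off `excess A`.
det-addOnes : (A : SquareMatrix (suc n)) → det (λ i j → A i j + 1ℤ) ≡ det A + excess A
det-addOnes A = begin
  det A⁺
    ≡⟨ det-differences A⁺ ⟨
  det (A⁺ zero ∷ differences A⁺)
    ≡⟨ det-linear zero 1ℤ {A zero ∷ differences A} {const 1ℤ ∷ differences A}
         {A⁺ zero ∷ differences A⁺} (λ _ → refl)
         (λ { zero 0≢0 → contradiction refl 0≢0 ; (suc i) _ j → shift (A (suc i) j) (A zero j) })
         (λ { zero 0≢0 → contradiction refl 0≢0 ; (suc i) _ j → shift (A (suc i) j) (A zero j) }) ⟩
  det (A zero ∷ differences A) + 1ℤ * excess A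
    ≡⟨ cong₂ _+_ (det-differences A) (*-identityˡ (excess A)) ⟩
  det A + excess A ∎
  where
  A⁺ : SquareMatrix _
  A⁺ i j = A i j + 1ℤ
  shift : ∀ a b → (a + 1ℤ) + -1ℤ * (b + 1ℤ) ≡ a + -1ℤ * b
  shift = solve-∀

joinBlock : SquareMatrix p → SquareMatrix q → BlockMatrix p q
joinBlock A B = block A (λ _ _ → 1ℤ) (λ _ _ → -1ℤ) B

-- Subtracting the first row of either block from the others leaves the
-- off-diagonal blocks with one nonzero row each.  Splitting these two rows by
-- linearity gives determinants that are block triangular up to a row swap.
det-joinBlock : (A : SquareMatrix (suc p)) (B : SquareMatrix (suc q)) →
                det (flatten (joinBlock A B)) ≡ det A * det B + excess A * excess B
det-joinBlock {p} {q} A B = begin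
  det (flatten (joinBlock A B))
    ≡⟨ flatten-addMultiples (inj₁ zero) c₁ {joinBlock A B} {M₁} refl op₁ ⟨
  det (flatten M₁)
    ≡⟨ flatten-addMultiples (inj₂ zero) c₂ {M₁} {M₂ (A zero) 1s -1s (B zero)} refl op₂ ⟨
  det (flatten (M₂ (A zero) 1s -1s (B zero)))
    ≡⟨ flatten-linear (inj₁ zero) 1ℤ {M₂ (A zero) 0s -1s (B zero)} {M₂ 0s 1s -1s (B zero)} {M₂ (A zero) 1s -1s (B zero)}
         (λ { (inj₁ j) → sym (+-identityʳ (A zero j)) ; (inj₂ _) → refl })
         (offTop (λ { _ (inj₁ _) → refl ; _ (inj₂ _) → refl })
                 (λ { zero (inj₁ _) → refl ; (suc _) (inj₁ _) → refl ; _ (inj₂ _) → refl }))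
         (offTop (λ { _ (inj₁ _) → refl ; _ (inj₂ _) → refl })
                 (λ { zero (inj₁ _) → refl ; (suc _) (inj₁ _) → refl ; _ (inj₂ _) → refl })) ⟩
  det (flatten (M₂ (A zero) 0s -1s (B zero))) + 1ℤ * det (flatten (M₂ 0s 1s -1s (B zero)))
    ≡⟨ cong₂ (λ x y → x + 1ℤ * y)
         (det-lowerBlock (A zero ∷ differences A) (-1s ∷ const 0s) (B zero ∷ differences B)
                         (λ { zero _ → refl ; (suc _) _ → refl }))
         (flatten-linear (inj₂ zero) 1ℤ {M₂ 0s 1s 0s (B zero)} {M₂ 0s 1s -1s 0s} {M₂ 0s 1s -1s (B zero)}
         (λ { (inj₁ _) → refl ; (inj₂ j) → sym (+-identityʳ (B zero j)) })
         (offBottom (λ { _ (inj₁ _) → refl ; _ (inj₂ _) → refl })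
                    (λ { _ (inj₁ _) → refl ; _ (inj₂ _) → refl }))
         (offBottom (λ { _ (inj₁ _) → refl ; _ (inj₂ _) → refl })
                    (λ { _ (inj₁ _) → refl ; _ (inj₂ _) → refl }))) ⟩
  det (A zero ∷ differences A) * det (B zero ∷ differences B) +
    1ℤ * (det (flatten (M₂ 0s 1s 0s (B zero))) + 1ℤ * det (flatten (M₂ 0s 1s -1s 0s)))
    ≡⟨ cong₂ (λ x y → det (A zero ∷ differences A) * det (B zero ∷ differences B) + 1ℤ * (x + 1ℤ * y))
         -- The upper left block has a zero first row, so this term vanishes in the next step.
         (det-upperBlock (0s ∷ differences A) (1s ∷ const 0s) (B zero ∷ differences B)
                         (λ { zero _ → refl ; (suc _) _ → refl }))
         swapped ⟩
  det (A zero ∷ differences A) * det (B zero ∷ differences B) +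
    1ℤ * (det (0s ∷ differences A) * det (B zero ∷ differences B) +
          1ℤ * (- (det (-1s ∷ differences A) * excess B)))
    ≡⟨ cong₂ (λ x y → det (A zero ∷ differences A) * det (B zero ∷ differences B) +
                      1ℤ * (x * det (B zero ∷ differences B) + 1ℤ * (- (y * excess B))))
         (laplace-zero (0s ∷ differences A) (λ _ → inj₁ refl)) negated ⟩
  det (A zero ∷ differences A) * det (B zero ∷ differences B) +
    1ℤ * (0ℤ * det (B zero ∷ differences B) + 1ℤ * (- (-1ℤ * excess A * excess B)))
    ≡⟨ cong₂ (λ x y → x * y + 1ℤ * (0ℤ * det (B zero ∷ differences B) +
                                    1ℤ * (- (-1ℤ * excess A * excess B))))
             (det-differences A) (det-differences B) ⟩
  det A * det B + 1ℤ * (0ℤ * det (B zero ∷ differences B) + 1ℤ * (- (-1ℤ * excess A * excess B)))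
    ≡⟨ simplify (det A * det B) (excess A) (excess B) (det (B zero ∷ differences B)) ⟩
  det A * det B + excess A * excess B ∎
  where
  0s 1s -1s : ∀ {n} → Vector ℤ n
  0s  = const 0ℤ
  1s  = const 1ℤ
  -1s = const -1ℤ
  M₁ : BlockMatrix (suc p) (suc q)
  M₁ = block (A zero ∷ differences A) (1s ∷ const 0s) (const -1s) B
  -- The fully reduced matrix, with the first row `(a | u)` of the upper half and the first row
  -- `(c | b)` of the lower half left free. The terms of the expansion differ only in these two
  -- rows.
  M₂ : Vector ℤ (suc p) → Vector ℤ (suc q) → Vector ℤ (suc p) → Vector ℤ (suc q) →
       BlockMatrix (suc p) (suc q)
  M₂ a u c b = block (a ∷ differences A) (u ∷ const 0s) (c ∷ const 0s) (b ∷ differences B)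
  c₁ c₂ : Fin (suc p) ⊎ Fin (suc q) → ℤ
  c₁ (inj₁ zero)    = 0ℤ
  c₁ (inj₁ (suc _)) = -1ℤ
  c₁ (inj₂ _)       = 0ℤ
  c₂ (inj₁ _)       = 0ℤ
  c₂ (inj₂ zero)    = 0ℤ
  c₂ (inj₂ (suc _)) = -1ℤ
  op₁ : ∀ z y → M₁ z y ≡ joinBlock A B z y + c₁ z * joinBlock A B (inj₁ zero) y
  op₁ (inj₁ zero)    (inj₁ j) = sym (+-identityʳ (A zero j))
  op₁ (inj₁ zero)    (inj₂ _) = refl
  op₁ (inj₁ (suc _)) (inj₁ _) = refl
  op₁ (inj₁ (suc _)) (inj₂ _) = refl
  op₁ (inj₂ _)       (inj₁ _) = refl
  op₁ (inj₂ i)       (inj₂ j) = sym (+-identityʳ (B i j))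
  op₂ : ∀ z y → M₂ (A zero) 1s -1s (B zero) z y ≡ M₁ z y + c₂ z * M₁ (inj₂ zero) y
  op₂ (inj₁ i)       (inj₁ j) = sym (+-identityʳ _)
  op₂ (inj₁ zero)    (inj₂ _) = refl
  op₂ (inj₁ (suc _)) (inj₂ _) = refl
  op₂ (inj₂ zero)    (inj₁ _) = refl
  op₂ (inj₂ zero)    (inj₂ j) = sym (+-identityʳ (B zero j))
  op₂ (inj₂ (suc _)) (inj₁ _) = refl
  op₂ (inj₂ (suc _)) (inj₂ _) = refl
  offTop : {P : Fin (suc p) ⊎ Fin (suc q) → Set} →
           (∀ i → P (inj₁ (suc i))) → (∀ i → P (inj₂ i)) → ∀ z → z ≢ inj₁ zero → P z
  offTop f g (inj₁ zero)    z≢ = contradiction refl z≢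
  offTop f g (inj₁ (suc i)) _  = f i
  offTop f g (inj₂ i)       _  = g i
  offBottom : {P : Fin (suc p) ⊎ Fin (suc q) → Set} →
              (∀ i → P (inj₁ i)) → (∀ i → P (inj₂ (suc i))) → ∀ z → z ≢ inj₂ zero → P z
  offBottom f g (inj₁ i)       _  = f i
  offBottom f g (inj₂ zero)    z≢ = contradiction refl z≢
  offBottom f g (inj₂ (suc i)) _  = g i
  -- Exchanging the rows `(0 | 1)` and `(-1 | 0)` makes the matrix block triangular. The sign of the
  -- exchange cancels the sign that `negated` extracts.
  swapped : det (flatten (M₂ 0s 1s -1s 0s)) ≡ - (det (-1s ∷ differences A) * excess B)
  swapped = trans
    (flatten-swapRows (inj₁ zero) (inj₂ zero) (λ ()) {M₂ -1s 0s 0s 1s} {M₂ 0s 1s -1s 0s}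
      (λ { (inj₁ _) → refl ; (inj₂ _) → refl })
      (λ { (inj₁ _) → refl ; (inj₂ _) → refl })
      (offTop (λ { _ _ (inj₁ _) → refl ; _ _ (inj₂ _) → refl })
              (λ { zero z≢ → contradiction refl z≢
                 ; (suc _) _ (inj₁ _) → refl ; (suc _) _ (inj₂ _) → refl })))
    (cong -_ (det-lowerBlock (-1s ∷ differences A) (0s ∷ const 0s) (1s ∷ differences B)
                             (λ { zero _ → refl ; (suc _) _ → refl })))
  -- Homogeneity is obtained from `det-linear` by writing the row as the zero row plus `-1ℤ` times
  -- the row of ones.
  negated : det (-1s ∷ differences A) ≡ -1ℤ * excess A
  negated = trans
    (det-linear zero -1ℤ {0s ∷ differences A} {1s ∷ differences A} { -1s ∷ differences A} (λ _ → refl)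
      (λ { zero 0≢0 → contradiction refl 0≢0 ; (suc _) _ _ → refl })
      (λ { zero 0≢0 → contradiction refl 0≢0 ; (suc _) _ _ → refl }))
    (trans (cong (_+ -1ℤ * excess A) (laplace-zero (0s ∷ differences A) (λ _ → inj₁ refl)))
           (+-identityˡ (-1ℤ * excess A)))
  simplify : ∀ x a b d → x + 1ℤ * (0ℤ * d + 1ℤ * (- (-1ℤ * a * b))) ≡ x + a * b
  simplify = solve-∀

-- Skew-symmetry and parity

i≡-i⇒i≡0 : ∀ {i} → i ≡ - i → i ≡ 0ℤ
i≡-i⇒i≡0 {Int.+ zero} _ = refl

2∤n⇒2∣n+1 : 2 ∤ n → 2 ∣ n ℕ.+ 1
2∤n⇒2∣n+1 {zero}        2∤0   = contradiction (2 ∣0) 2∤0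
2∤n⇒2∣n+1 {suc zero}    _     = ∣-refl
2∤n⇒2∣n+1 {suc (suc n)} 2∤2+n = ∣m∣n⇒∣m+n ∣-refl (2∤n⇒2∣n+1 (2∤2+n ∘ ∣m∣n⇒∣m+n ∣-refl))

2∣n⇒2∤n+1 : 2 ∣ n → 2 ∤ n ℕ.+ 1
2∣n⇒2∤n+1 2∣n 2∣n+1 with () ← ∣1⇒≡1 (∣m+n∣m⇒∣n 2∣n+1 2∣n)

-1^odd : 2 ∤ n → -1ℤ ^ n ≡ -1ℤ
-1^odd {zero}        2∤0   = contradiction (2 ∣0) 2∤0
-1^odd {suc zero}    _     = refl
-1^odd {suc (suc n)} 2∤2+n = cong (λ z → -1ℤ * (-1ℤ * z)) (-1^odd (2∤2+n ∘ ∣m∣n⇒∣m+n ∣-refl))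

-- `M` is the negative of its transpose, and negating an odd number of rows changes the sign of the
-- determinant.
det-skewOdd : (M : SquareMatrix n) → (∀ i j → M i j ≡ - M j i) → 2 ∤ n → det M ≡ 0ℤ
det-skewOdd {n} M skew 2∤n = i≡-i⇒i≡0 (begin
  det M                         ≡⟨ det-cong skew ⟩
  det (λ i j → - M j i)         ≡⟨ det-negate (λ i j → M j i) ⟩
  -1ℤ ^ n * det (λ i j → M j i) ≡⟨ cong₂ _*_ (-1^odd 2∤n) (det-transpose M) ⟩
  -1ℤ * det M                   ≡⟨ -1*i≡-i (det M) ⟩
  - det M                       ∎)

-- Determinants modulo 4

2ℤ 4ℤ : ℤ
2ℤ = Int.+ 2
4ℤ = Int.+ 4

∣-sum : ∀ {k} (f : Vector ℤ n) → (∀ i → k Signed.∣ f i) → k Signed.∣ sum f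
∣-sum {zero}  f k∣f = divides 0ℤ refl
∣-sum {suc n} f k∣f = Signed.∣m∣n⇒∣m+n (k∣f zero) (∣-sum (f ∘ suc) (k∣f ∘ suc))

2∣-*-2∣ : ∀ {i j} → 2ℤ Signed.∣ i → 2ℤ Signed.∣ j → 4ℤ Signed.∣ i * j
2∣-*-2∣ (divides a refl) (divides b refl) = divides (a * b) (rearrange a b)
  where
  rearrange : ∀ a b → (a * 2ℤ) * (b * 2ℤ) ≡ (a * b) * 4ℤ
  rearrange = solve-∀

det-evenFirstColumn : (M : SquareMatrix (suc n)) → (∀ i → 2ℤ Signed.∣ M i zero) → 2ℤ Signed.∣ det M
det-evenFirstColumn M even = subst (2ℤ Signed.∣_) (sym (det-firstColumn M))
  (∣-sum _ λ i → Signed.∣n⇒∣m*n (-1ℤ ^ toℕ i)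
    (Signed.∣m⇒∣m*n (det λ k l → M (punchIn i k) (suc l)) (even i)))

-- Deleting a later column keeps the first one, minus its top entry. Splitting on the size exposes
-- that column in the minor.
minor-evenFirstColumn : (M : SquareMatrix (suc n)) → (∀ i → 2ℤ Signed.∣ M (suc i) zero) →
                        ∀ j → 2ℤ Signed.∣ det (minor M (suc j))
minor-evenFirstColumn {suc n} M even j = det-evenFirstColumn (minor M (suc j)) even

-- Each Laplace term after the first is an even entry times a minor with an even first column, hence
-- a multiple of 4. The first term is a smaller matrix of the same kind.
det-unitDiagonal-evenOffDiagonal : (M : SquareMatrix n) → (∀ i → M i i ≡ 1ℤ) →
                                   (∀ i j → i ≢ j → 2ℤ Signed.∣ M i j) →
                                   4ℤ Signed.∣ det M - 1ℤ
det-unitDiagonal-evenOffDiagonal {zero}  M unit even = divides 0ℤ refl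
det-unitDiagonal-evenOffDiagonal {suc n} M unit even =
  subst (4ℤ Signed.∣_) expansion
    (Signed.∣m∣n⇒∣m+n
      (det-unitDiagonal-evenOffDiagonal (minor M zero) (unit ∘ suc)
        (λ i j i≢j → even (suc i) (suc j) (i≢j ∘ suc-injective)))
      (∣-sum (laplaceTerm M ∘ suc) λ j → Signed.∣n⇒∣m*n (-1ℤ ^ toℕ (suc j))
        (2∣-*-2∣ (even zero (suc j) 0≢1+n)
                 (minor-evenFirstColumn M (λ i → even (suc i) zero (λ ())) j))))
  where
  rest = sum (laplaceTerm M ∘ suc)
  expansion : det (minor M zero) - 1ℤ + rest ≡ det M - 1ℤ
  expansion = trans (regroup (det (minor M zero)) rest)
                    (cong (λ a → 1ℤ * (a * det (minor M zero)) + rest - 1ℤ) (sym (unit zero)))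
    where
    regroup : ∀ d r → d - 1ℤ + r ≡ 1ℤ * (1ℤ * d) + r - 1ℤ
    regroup = solve-∀

-- Tournaments

skewAdjacency-skew : (T : Tournament n) → ∀ i j → skewAdjacency T i j ≡ - skewAdjacency T j i
skewAdjacency-skew T i j with compare T i j | compare T j i
... | tri< i→j _ _   | tri< _ _ i↛j   = contradiction i→j i↛j
... | tri< _ i≢j _   | tri≈ _ j≡i _   = contradiction (sym j≡i) i≢j
... | tri< _ _ _     | tri> _ _ _     = refl
... | tri≈ _ i≡j _   | tri< _ j≢i _   = contradiction (sym i≡j) j≢i
... | tri≈ _ _ _     | tri≈ _ _ _     = refl
... | tri≈ _ i≡j _   | tri> _ j≢i _   = contradiction (sym i≡j) j≢i
... | tri> _ _ _     | tri< _ _ _     = refl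
... | tri> _ i≢j _   | tri≈ _ j≡i _   = contradiction (sym j≡i) i≢j
... | tri> i↛j _ _   | tri> _ _ i→j   = contradiction i→j i↛j

module _ (T₁ : Tournament p) (T₂ : Tournament q) where

  sign-⊎-<-trichotomous : ∀ x y → sign (⊎-<-trichotomous (compare T₁) (compare T₂) x y) ≡
                                  joinBlock (skewAdjacency T₁) (skewAdjacency T₂) x y
  sign-⊎-<-trichotomous (inj₁ i) (inj₁ j) with compare T₁ i j
  ... | tri< _ _ _ = refl
  ... | tri≈ _ _ _ = refl
  ... | tri> _ _ _ = refl
  sign-⊎-<-trichotomous (inj₁ _) (inj₂ _) = refl
  sign-⊎-<-trichotomous (inj₂ _) (inj₁ _) = refl
  sign-⊎-<-trichotomous (inj₂ i) (inj₂ j) with compare T₂ i j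
  ... | tri< _ _ _ = refl
  ... | tri≈ _ _ _ = refl
  ... | tri> _ _ _ = refl

  -- The `transfer` inside `_⇒_` preserves the constructor of the comparison, which is all that
  -- `sign` inspects.
  skewAdjacency-⇒ : ∀ i j → skewAdjacency (T₁ ⇒ T₂) i j ≡
                            flatten (joinBlock (skewAdjacency T₁) (skewAdjacency T₂)) i j
  skewAdjacency-⇒ i j
    with ⊎-<-trichotomous (compare T₁) (compare T₂) (splitAt p i) (splitAt p j)
       | sign-⊎-<-trichotomous (splitAt p i) (splitAt p j)
  ... | tri< _ _ _ | eq = eq
  ... | tri≈ _ _ _ | eq = eq
  ... | tri> _ _ _ | eq = eq

-- The matrix of the one-vertex tournament has determinant 0 and excess 1.
detT-⁺ : (T : Tournament (suc n)) → detT (T ⁺) ≡ excess (skewAdjacency T)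
detT-⁺ T = begin
  detT (T ⁺)                 ≡⟨ det-cong (skewAdjacency-⇒ T oneVertex) ⟩
  det (flatten (joinBlock S (skewAdjacency oneVertex)))
                             ≡⟨ det-joinBlock S (skewAdjacency oneVertex) ⟩
  det S * 0ℤ + excess S * 1ℤ ≡⟨ cong₂ _+_ (*-zeroʳ (det S)) (*-identityʳ (excess S)) ⟩
  0ℤ + excess S              ≡⟨ +-identityˡ (excess S) ⟩
  excess S                   ∎
  where
  S = skewAdjacency T

detT-odd : 2 ∤ n → (T : Tournament n) → detT T ≡ 0ℤ
detT-odd 2∤n T = det-skewOdd (skewAdjacency T) (skewAdjacency-skew T) 2∤n

-- The excess is the determinant of `T ⁺`, which has odd order.
excess-even : 2 ∣ suc n → (T : Tournament (suc n)) → excess (skewAdjacency T) ≡ 0ℤ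
excess-even 2∣n T = trans (sym (detT-⁺ T)) (detT-odd (2∣n⇒2∤n+1 2∣n) (T ⁺))

-- Adding 1 to every entry keeps the determinant and makes the diagonal 1 and
-- the other entries 0 or 2.
detT-even : 2 ∣ n → (T : Tournament n) → 4ℤ Signed.∣ detT T - 1ℤ
detT-even {zero}  _   T = divides 0ℤ refl
detT-even {suc n} 2∣n T = subst (λ d → 4ℤ Signed.∣ d - 1ℤ) same
  (det-unitDiagonal-evenOffDiagonal (λ i j → S i j + 1ℤ)
    (λ i → cong (_+ 1ℤ) (i≡-i⇒i≡0 (skewAdjacency-skew T i i))) even)
  where
  S = skewAdjacency T
  same : det (λ i j → S i j + 1ℤ) ≡ det S
  same = trans (det-addOnes S) (trans (cong (λ e → det S + e) (excess-even 2∣n T)) (+-identityʳ (det S)))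
  even : ∀ i j → i ≢ j → 2ℤ Signed.∣ S i j + 1ℤ
  even i j i≢j with compare T i j
  ... | tri< _ _ _   = divides 1ℤ refl
  ... | tri≈ _ i≡j _ = contradiction i≡j i≢j
  ... | tri> _ _ _   = divides 0ℤ refl

-- Determinants of joins and unimodularity

detT-⇒-even : ∀ p q → 2 ∣ p → 2 ∣ q → (T₁ : Tournament p) (T₂ : Tournament q) →
              detT (T₁ ⇒ T₂) ≡ detT T₁ * detT T₂
-- `excess` is defined only for nonempty matrices. If either tournament is empty, the upper right
-- block has no entries and the matrix is block triangular.
detT-⇒-even zero q _ _ T₁ T₂ = trans (det-cong (skewAdjacency-⇒ T₁ T₂))
  (det-lowerBlock (skewAdjacency T₁) {λ _ _ → 1ℤ} (λ _ _ → -1ℤ) (skewAdjacency T₂) (λ ()))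
detT-⇒-even (suc p) zero _ _ T₁ T₂ = trans (det-cong (skewAdjacency-⇒ T₁ T₂))
  (det-lowerBlock (skewAdjacency T₁) (λ _ _ → -1ℤ) (skewAdjacency T₂) (λ _ ()))
detT-⇒-even (suc p) (suc q) 2∣p _ T₁ T₂ = begin
  detT (T₁ ⇒ T₂)
    ≡⟨ det-cong (skewAdjacency-⇒ T₁ T₂) ⟩
  det (flatten (joinBlock (skewAdjacency T₁) (skewAdjacency T₂)))
    ≡⟨ det-joinBlock (skewAdjacency T₁) (skewAdjacency T₂) ⟩
  detT T₁ * detT T₂ + excess (skewAdjacency T₁) * excess (skewAdjacency T₂)
    ≡⟨ cong (λ e → detT T₁ * detT T₂ + e * excess (skewAdjacency T₂)) (excess-even 2∣p T₁) ⟩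
  detT T₁ * detT T₂ + 0ℤ
    ≡⟨ +-identityʳ (detT T₁ * detT T₂) ⟩
  detT T₁ * detT T₂ ∎

detT-⇒-odd : ∀ p q → 2 ∤ p → 2 ∤ q → (T₁ : Tournament p) (T₂ : Tournament q) →
             detT (T₁ ⇒ T₂) ≡ detT (T₁ ⁺) * detT (T₂ ⁺)
detT-⇒-odd zero    q       2∤p _   T₁ T₂ = contradiction (2 ∣0) 2∤p
detT-⇒-odd (suc p) zero    _   2∤q T₁ T₂ = contradiction (2 ∣0) 2∤q
detT-⇒-odd (suc p) (suc q) 2∤p _   T₁ T₂ = begin
  detT (T₁ ⇒ T₂)
    ≡⟨ det-cong (skewAdjacency-⇒ T₁ T₂) ⟩
  det (flatten (joinBlock (skewAdjacency T₁) (skewAdjacency T₂)))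
    ≡⟨ det-joinBlock (skewAdjacency T₁) (skewAdjacency T₂) ⟩
  detT T₁ * detT T₂ + excess (skewAdjacency T₁) * excess (skewAdjacency T₂)
    ≡⟨ cong₂ (λ d e → d * detT T₂ + e) (detT-odd 2∤p T₁)
             (cong₂ _*_ (sym (detT-⁺ T₁)) (sym (detT-⁺ T₂))) ⟩
  0ℤ + detT (T₁ ⁺) * detT (T₂ ⁺)
    ≡⟨ +-identityˡ (detT (T₁ ⁺) * detT (T₂ ⁺)) ⟩
  detT (T₁ ⁺) * detT (T₂ ⁺) ∎

-- A divisor of 1 has absolute value 1, and -1 is excluded because 4 does not divide -2.
4∣i-1⇒i*j≡1⇒i≡1 : ∀ {i j} → 4ℤ Signed.∣ i - 1ℤ → i * j ≡ 1ℤ → i ≡ 1ℤ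
4∣i-1⇒i*j≡1⇒i≡1 {i} {j} 4∣i-1 ij≡1
  with i | 4∣i-1 | ℕ.m*n≡1⇒m≡1 ∣ i ∣ ∣ j ∣ (trans (sym (abs-* i j)) (cong ∣_∣ ij≡1))
... | Int.+ _      | _    | refl = refl
... | Int.-[1+ _ ] | 4∣-2 | refl = contradiction 4∣-2 (from-no (4ℤ Signed.∣? (-1ℤ - 1ℤ)))

-- The congruence settles both factors: once `i` is 1, the product is `j`.
product≡1⇔ : ∀ {d i j} → d ≡ i * j → 4ℤ Signed.∣ i - 1ℤ → d ≡ 1ℤ ⇔ (i ≡ 1ℤ × j ≡ 1ℤ)
product≡1⇔ {d} {i} {j} d≡ij 4∣i-1 = mk⇔ to λ { (refl , refl) → d≡ij }
  where
  to : d ≡ 1ℤ → i ≡ 1ℤ × j ≡ 1ℤ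
  to d≡1 = i≡1 , trans (sym (*-identityˡ j)) (trans (cong (_* j) (sym i≡1)) ij≡1)
    where
    ij≡1 = trans (sym d≡ij) d≡1
    i≡1 = 4∣i-1⇒i*j≡1⇒i≡1 {i} {j} 4∣i-1 ij≡1

theorem1p2 : ∀ (p q : ℕ) (T₁ : Tournament p) (T₂ : Tournament q) →
    (2 ∣ p → 2 ∣ q → Unimodular (T₁ ⇒ T₂) ⇔ (Unimodular T₁ × Unimodular T₂)) ×
    (2 ∤ p → 2 ∤ q → Unimodular (T₁ ⇒ T₂) ⇔ (Unimodular (T₁ ⁺) × Unimodular (T₂ ⁺)))
theorem1p2 p q T₁ T₂ =
  (λ 2∣p 2∣q → product≡1⇔ (detT-⇒-even p q 2∣p 2∣q T₁ T₂) (detT-even 2∣p T₁)) ,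
  -- `T₁ ⁺` has even order, so its determinant is 1 modulo 4.
  (λ 2∤p 2∤q → product≡1⇔ (detT-⇒-odd p q 2∤p 2∤q T₁ T₂) (detT-even (2∤n⇒2∣n+1 2∤p) (T₁ ⁺)))
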